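{- There is an absolute constant $c>0$ such that the following holds for all integers $N,k\ge1$ with $2k\le N$. Let $\mathcal{M}_{N,k}$ be the family of priors $\mu^k$, where $\mu$ ranges over all probability distributions on $[N]$ with $\operatorname{supp}(\mu)\subseteq M$ for some $M\subseteq[N]$ with $|M|=2k$. Let $(\mathsf{Enc},\mathsf{Dec})$ be a deterministic entropy-asymmetric-coding scheme with message length $m$ (no linearity or computational efficiency is assumed) that handles all priors $\sigma=\mu^k\in\mathcal{M}_{N,k}$ with error $\delta=0$, i.e. $$\Pr_{S\sim\sigma}[\mathsf{Dec}_\sigma(\mathsf{Enc}(S))=S]=1\quad\text{for every }\sigma\in\mathcal{M}_{N,k}.$$ Then $m\ge c\,k\lg(N/k)$. This holds even though the information-theoretic minimum $m^*=k\,H(\mu)$ satisfies $m^*\le k\lg(2k)$ for every $\mu^k\in\mathcal{M}_{N,k}$.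
   Context: $[N]=\{1,\dots,N\}$, $\lg$ is the base-2 logarithm, and $H(\mu)=\sum_i\mu(i)\lg(1/\mu(i))$ is the Shannon entropy. The prior $\mu^k$ generates the random set $S\subseteq[N]$ consisting of $k$ items drawn i.i.d. from $\mu$. A deterministic scheme consists of a fixed encoding function $\mathsf{Enc}:2^{[N]}\to\{0,1\}^m$ that does not depend on the prior, and, for each prior $\sigma$ (the decoder's side information), a decoding function $\mathsf{Dec}_\sigma:\{0,1\}^m\to2^{[N]}$. -}

module Defs where

open import Level using (suc; _⊔_)
open import Algebra.Apartness.Bundles using (HeytingField)
open import Algebra.Bundles using (CommutativeMonoid; CommutativeRing)
import Algebra.Definitions.RawMonoid as RawMonoid
open import Data.Bool.Base using (Bool; true; false; if_then_else_)
import Data.Bool.Properties as Bool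
open import Data.Fin.Base using (Fin)
open import Data.Fin.Subset using (Subset; ⁅_⁆; ⋃; ∣_∣; _∈_)
open import Data.List.Base as List using (List; []; _∷_; allFin; cartesianProductWith; filter)
open import Data.List.Membership.Propositional using () renaming (_∈_ to _∈ˡ_)
open import Data.List.Membership.Propositional.Properties using (∈-cartesianProductWith⁺)
open import Data.List.Relation.Unary.All using (All; []; _∷_)
open import Data.List.Relation.Unary.AllPairs using ([]; _∷_)
open import Data.List.Relation.Unary.Any using (here; there)
open import Data.List.Relation.Unary.Unique.Propositional using (Unique)
import Data.List.Relation.Unary.Unique.Propositional.Properties as Unique
open import Data.Nat.Base as ℕ using (ℕ; zero; NonZero)
open import Data.Nat.Properties using (m*n≢0)
open import Data.Product.Base using (∃-syntax; _×_; _,_; proj₁)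
open import Data.Sum.Base using (_⊎_; inj₁; inj₂)
open import Data.Vec.Base as Vec using (Vec; []; _∷_)
import Data.Vec.Properties as Vec
open import Relation.Binary.Core using (Rel)
open import Relation.Binary.Definitions using (DecidableEquality)
open import Relation.Binary.PropositionalEquality as ≡ using (_≡_)
open import Relation.Binary.Structures using (IsStrictPartialOrder)
open import Relation.Nullary using (¬_; yes; no; does; contradiction)
open import Relation.Unary using (Pred; Decidable)

-- The real numbers, given axiomatically as a Cauchy-complete Archimedean
-- ordered field.  Any two such fields are isomorphic.  The axioms are
-- constructive: equality and order are not assumed decidable.

record RealNumbers c ℓ₁ ℓ₂ ℓ₃ : Set (suc (c ⊔ ℓ₁ ⊔ ℓ₂ ⊔ ℓ₃)) where
  infix 4 _<_ _≤_

  field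
    heytingField : HeytingField c ℓ₁ ℓ₂

  open HeytingField heytingField public

  commutativeRing : CommutativeRing c ℓ₁
  commutativeRing = record { isCommutativeRing = isCommutativeRing }

  open CommutativeRing commutativeRing public
    using (ring; +-rawMonoid; +-commutativeMonoid)

  open RawMonoid +-rawMonoid public
    using () renaming (_×_ to _·_)

  fromℕ : ℕ → Carrier
  fromℕ n = n · 1#

  field
    _<_                  : Rel Carrier ℓ₃
    <-isStrictPartialOrder : IsStrictPartialOrder _≈_ _<_
    <⇒#                  : ∀ {x y} → x < y → x # y
    #⇒<⊎>                : ∀ {x y} → x # y → (x < y) ⊎ (y < x)
    +-monoʳ-<            : ∀ z {x y} → x < y → z + x < z + y
    *-pos                : ∀ {x y} → 0# < x → 0# < y → 0# < x * y
    archimedean          : ∀ x → ∃[ n ] x < fromℕ n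

  _≤_ : Rel Carrier ℓ₃
  x ≤ y = ¬ (y < x)

  -- Every pair of indices is compared in both orders, so this bounds the
  -- absolute value of the difference.
  IsCauchy : (ℕ → Carrier) → Set (c ⊔ ℓ₃)
  IsCauchy s = ∀ ε → 0# < ε → ∃[ n ] ∀ i j → n ℕ.≤ i → n ℕ.≤ j → s i < s j + ε

  ConvergesTo : (ℕ → Carrier) → Carrier → Set (c ⊔ ℓ₃)
  ConvergesTo s l = ∀ ε → 0# < ε → ∃[ n ] ∀ i → n ℕ.≤ i → (s i < l + ε) × (l < s i + ε)

  field
    complete : ∀ s → IsCauchy s → ∃[ l ] ConvergesTo s l

module Positive {c ℓ₁ ℓ₂ ℓ₃} (ℝ : RealNumbers c ℓ₁ ℓ₂ ℓ₃) where
  open RealNumbers ℝ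
  open IsStrictPartialOrder <-isStrictPartialOrder public
    using (<-respˡ-≈; <-respʳ-≈)
    renaming (irrefl to <-irrefl; trans to <-trans)
  open import Algebra.Apartness.Properties.HeytingCommutativeRing
    (HeytingField.heytingCommutativeRing heytingField) using (1#0; x-0≈x; invertibleˡ⇒#)
  open import Algebra.Properties.Ring ring using (-‿distribʳ-*; -‿distribˡ-*; -‿involutive)
  open import Relation.Binary.Reasoning.Setoid setoid

  private variable x y : Carrier

  neg⇒0<- : x < 0# → 0# < - x
  neg⇒0<- {x} x<0 =
    <-respˡ-≈ (-‿inverseˡ x) (<-respʳ-≈ (+-identityʳ (- x)) (+-monoʳ-< (- x) x<0))

  +-pos : 0# < x → 0# < y → 0# < x + y
  +-pos {x} 0<x 0<y = <-trans 0<x (<-respˡ-≈ (+-identityʳ x) (+-monoʳ-< x 0<y))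

  0<1 : 0# < 1#
  0<1 with #⇒<⊎> 1#0
  ... | inj₂ 0<1′ = 0<1′
  ... | inj₁ 1<0  = <-respʳ-≈ (begin
    - 1# * - 1#     ≈⟨ -‿distribˡ-* 1# (- 1#) ⟨
    - (1# * - 1#)   ≈⟨ -‿cong (*-identityˡ (- 1#)) ⟩
    - (- 1#)        ≈⟨ -‿involutive 1# ⟩
    1#              ∎) (*-pos (neg⇒0<- 1<0) (neg⇒0<- 1<0))

  ℝ⁺ : Set (c ⊔ ℓ₃)
  ℝ⁺ = ∃[ x ] 0# < x

  reciprocal : 0# < x → ∃[ y ] ((x * y ≈ 1#) × 0# < y)
  reciprocal {x} 0<x with #⇒invertible (#-sym (<⇒# 0<x))
  ... | y , _ , xy≈1′ = y , xy≈1 , positive (#⇒<⊎> y#0)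
    where
    xy≈1 : x * y ≈ 1#
    xy≈1 = trans (*-congʳ (sym (x-0≈x x))) xy≈1′

    y#0 : y # 0#
    y#0 = invertibleˡ⇒# (x , trans (*-congˡ (x-0≈x y)) xy≈1)

    positive : (y < 0#) ⊎ (0# < y) → 0# < y
    positive (inj₂ 0<y) = 0<y
    positive (inj₁ y<0) = contradiction (<-trans 0<-1 -1<0) (<-irrefl refl)
      where
      0<-1 : 0# < - 1#
      0<-1 = <-respʳ-≈ (trans (sym (-‿distribʳ-* x y)) (-‿cong xy≈1)) (*-pos 0<x (neg⇒0<- y<0))

      -1<0 : - 1# < 0#
      -1<0 = <-respˡ-≈ (+-identityʳ (- 1#)) (<-respʳ-≈ (-‿inverseˡ 1#) (+-monoʳ-< (- 1#) 0<1))

  infixl 7 _*⁺_ _/⁺_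

  _*⁺_ : ℝ⁺ → ℝ⁺ → ℝ⁺
  (x , 0<x) *⁺ (y , 0<y) = x * y , *-pos 0<x 0<y

  1/⁺_ : ℝ⁺ → ℝ⁺
  1/⁺ (x , 0<x) with reciprocal 0<x
  ... | y , _ , 0<y = y , 0<y

  _/⁺_ : ℝ⁺ → ℝ⁺ → ℝ⁺
  p /⁺ q = p *⁺ (1/⁺ q)

  fromℕ⁺ : (n : ℕ) .{{_ : NonZero n}} → ℝ⁺
  fromℕ⁺ (ℕ.suc n) = fromℕ (ℕ.suc n) , positive n
    where
    positive : ∀ n → 0# < fromℕ (ℕ.suc n)
    positive zero      = <-respʳ-≈ (sym (+-identityʳ 1#)) 0<1
    positive (ℕ.suc n) = +-pos 0<1 (positive n)

-- These laws determine lg uniquely on the positive reals.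

record BinaryLogarithm {c ℓ₁ ℓ₂ ℓ₃} (ℝ : RealNumbers c ℓ₁ ℓ₂ ℓ₃) : Set (c ⊔ ℓ₁ ⊔ ℓ₃) where
  open RealNumbers ℝ
  open Positive ℝ

  field
    lg        : ℝ⁺ → Carrier
    lg-cong   : ∀ p q → proj₁ p ≈ proj₁ q → lg p ≈ lg q
    lg-mono-< : ∀ p q → proj₁ p < proj₁ q → lg p < lg q
    lg-*      : ∀ p q → lg (p *⁺ q) ≈ lg p + lg q
    lg-2      : lg (fromℕ⁺ 2) ≈ 1#

vectors : ∀ {A : Set} → List A → ∀ n → List (Vec A n)
vectors xs zero      = [] ∷ []
vectors xs (ℕ.suc n) = cartesianProductWith _∷_ xs (vectors xs n)

vectors-unique : ∀ {A : Set} {xs : List A} → Unique xs → ∀ n → Unique (vectors xs n)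
vectors-unique u zero      = [] ∷ []
vectors-unique u (ℕ.suc n) =
  Unique.cartesianProductWith⁺ _∷_ Vec.∷-injective u (vectors-unique u n)

∈-vectors : ∀ {A : Set} {xs : List A} → (∀ x → x ∈ˡ xs) → ∀ {n} (v : Vec A n) → v ∈ˡ vectors xs n
∈-vectors all []      = here ≡.refl
∈-vectors all (x ∷ v) = ∈-cartesianProductWith⁺ _∷_ (all x) (∈-vectors all v)

subsets : ∀ N → List (Subset N)
subsets = vectors (false ∷ true ∷ [])

subsets-unique : ∀ N → Unique (subsets N)
subsets-unique = vectors-unique (((λ ()) ∷ []) ∷ [] ∷ [])

∈-subsets : ∀ {N} (S : Subset N) → S ∈ˡ subsets N
∈-subsets = ∈-vectors λ { false → here ≡.refl ; true → there (here ≡.refl) }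

_≟ˢ_ : ∀ {N} → DecidableEquality (Subset N)
_≟ˢ_ = Vec.≡-dec Bool._≟_

itemSet : ∀ {N k} → Vec (Fin N) k → Subset N
itemSet t = ⋃ (Vec.toList (Vec.map ⁅_⁆ t))

module Coding {c ℓ₁ ℓ₂ ℓ₃} (ℝ : RealNumbers c ℓ₁ ℓ₂ ℓ₃) (logarithm : BinaryLogarithm ℝ) where
  open RealNumbers ℝ public
  open Positive ℝ public
  open BinaryLogarithm logarithm public
  open import Relation.Binary.Reasoning.Setoid setoid
  open import Algebra.Properties.CommutativeSemigroup
    (CommutativeMonoid.commutativeSemigroup +-commutativeMonoid) using (interchange)

  private variable
    A B : Set
    N k m : ℕ

  NonNegative : Carrier → Set (ℓ₁ ⊔ ℓ₃)
  NonNegative x = (x ≈ 0#) ⊎ (0# < x)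

  sumOver : List A → (A → Carrier) → Carrier
  sumOver []       f = 0#
  sumOver (x ∷ xs) f = f x + sumOver xs f

  -- A probability distribution on a finite type, whose elements are listed
  -- (without repetition) by xs.  As NonNegative is a disjunction, the support
  -- is decidable.

  record Distribution {A : Set} (xs : List A) : Set (c ⊔ ℓ₁ ⊔ ℓ₃) where
    field
      mass    : A → Carrier
      nonNeg  : ∀ x → NonNegative (mass x)
      total≈1 : sumOver xs mass ≈ 1#

  open Distribution public

  ItemDistribution : ℕ → Set (c ⊔ ℓ₁ ⊔ ℓ₃)
  ItemDistribution N = Distribution (allFin N)

  Prior : ℕ → Set (c ⊔ ℓ₁ ⊔ ℓ₃)
  Prior N = Distribution (subsets N)

  Pr : ∀ {p} {xs : List A} → Distribution xs → {P : Pred A p} → Decidable P → Carrier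
  Pr {xs = xs} σ P? = sumOver (filter P? xs) (mass σ)

  entropyTerm : ∀ x → NonNegative x → Carrier
  entropyTerm x (inj₁ x≈0) = 0#
  entropyTerm x (inj₂ 0<x) = x * lg (1/⁺ (x , 0<x))

  H : ∀ {xs : List A} → Distribution xs → Carrier
  H {xs = xs} μ = sumOver xs λ x → entropyTerm (mass μ x) (nonNeg μ x)

  weight : (A → Carrier) → Vec A k → Carrier
  weight w []      = 1#
  weight w (x ∷ t) = w x * weight w t

  iidMass : (Fin N → Carrier) → ∀ k → Subset N → Carrier
  iidMass {N} w k S = sumOver (filter (λ t → itemSet t ≟ˢ S) (vectors (allFin N) k)) (weight w)

  nonNegative-+ : ∀ {x y} → NonNegative x → NonNegative y → NonNegative (x + y)
  nonNegative-+ (inj₁ x≈0) (inj₁ y≈0) = inj₁ (trans (+-cong x≈0 y≈0) (+-identityˡ 0#))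
  nonNegative-+ (inj₁ x≈0) (inj₂ 0<y) =
    inj₂ (<-respʳ-≈ (sym (trans (+-congʳ x≈0) (+-identityˡ _))) 0<y)
  nonNegative-+ (inj₂ 0<x) (inj₁ y≈0) =
    inj₂ (<-respʳ-≈ (sym (trans (+-congˡ y≈0) (+-identityʳ _))) 0<x)
  nonNegative-+ (inj₂ 0<x) (inj₂ 0<y) = inj₂ (+-pos 0<x 0<y)

  nonNegative-* : ∀ {x y} → NonNegative x → NonNegative y → NonNegative (x * y)
  nonNegative-* (inj₁ x≈0) _          = inj₁ (trans (*-congʳ x≈0) (zeroˡ _))
  nonNegative-* (inj₂ _)   (inj₁ y≈0) = inj₁ (trans (*-congˡ y≈0) (zeroʳ _))
  nonNegative-* (inj₂ 0<x) (inj₂ 0<y) = inj₂ (*-pos 0<x 0<y)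

  sumOver-nonNegative : ∀ (xs : List A) {f} → (∀ x → NonNegative (f x)) → NonNegative (sumOver xs f)
  sumOver-nonNegative []       f≥0 = inj₁ refl
  sumOver-nonNegative (x ∷ xs) f≥0 = nonNegative-+ (f≥0 x) (sumOver-nonNegative xs f≥0)

  weight-nonNegative : ∀ {w : A → Carrier} → (∀ x → NonNegative (w x)) →
                       (t : Vec A k) → NonNegative (weight w t)
  weight-nonNegative w≥0 []      = inj₂ 0<1
  weight-nonNegative w≥0 (x ∷ t) = nonNegative-* (w≥0 x) (weight-nonNegative w≥0 t)

  sumOver-cong : ∀ (xs : List A) {f g} → (∀ x → f x ≈ g x) → sumOver xs f ≈ sumOver xs g
  sumOver-cong []       f≈g = refl
  sumOver-cong (x ∷ xs) f≈g = +-cong (f≈g x) (sumOver-cong xs f≈g)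

  sumOver-0 : ∀ (xs : List A) → sumOver xs (λ _ → 0#) ≈ 0#
  sumOver-0 []       = refl
  sumOver-0 (x ∷ xs) = trans (+-identityˡ _) (sumOver-0 xs)

  sumOver-+ : ∀ (xs : List A) f g → sumOver xs (λ x → f x + g x) ≈ sumOver xs f + sumOver xs g
  sumOver-+ []       f g = sym (+-identityˡ 0#)
  sumOver-+ (x ∷ xs) f g = trans (+-congˡ (sumOver-+ xs f g)) (interchange _ _ _ _)

  sumOver-*ʳ : ∀ (xs : List A) f a → sumOver xs (λ x → f x * a) ≈ sumOver xs f * a
  sumOver-*ʳ []       f a = sym (zeroˡ a)
  sumOver-*ʳ (x ∷ xs) f a = trans (+-congˡ (sumOver-*ʳ xs f a)) (sym (distribʳ a _ _))

  sumOver-*ˡ : ∀ (xs : List A) a f → sumOver xs (λ x → a * f x) ≈ a * sumOver xs f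
  sumOver-*ˡ []       a f = sym (zeroʳ a)
  sumOver-*ˡ (x ∷ xs) a f = trans (+-congˡ (sumOver-*ˡ xs a f)) (sym (distribˡ a _ _))

  sumOver-++ : ∀ (xs ys : List A) f → sumOver (xs List.++ ys) f ≈ sumOver xs f + sumOver ys f
  sumOver-++ []       ys f = sym (+-identityˡ _)
  sumOver-++ (x ∷ xs) ys f = trans (+-congˡ (sumOver-++ xs ys f)) (sym (+-assoc _ _ _))

  sumOver-map : ∀ (g : A → B) xs f → sumOver (List.map g xs) f ≈ sumOver xs (λ x → f (g x))
  sumOver-map g []       f = refl
  sumOver-map g (x ∷ xs) f = +-congˡ (sumOver-map g xs f)

  sumOver-vectors-suc : ∀ (xs : List A) (ys : List (Vec A k)) f →
    sumOver (cartesianProductWith _∷_ xs ys) f ≈ sumOver xs λ x → sumOver ys λ t → f (x ∷ t)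
  sumOver-vectors-suc []       ys f = refl
  sumOver-vectors-suc (x ∷ xs) ys f =
    trans (sumOver-++ (List.map (x ∷_) ys) _ f)
          (+-cong (sumOver-map (x ∷_) ys f) (sumOver-vectors-suc xs ys f))

  sumOver-weight : ∀ (xs : List A) w k → sumOver xs w ≈ 1# → sumOver (vectors xs k) (weight w) ≈ 1#
  sumOver-weight xs w zero      Σw≈1 = +-identityʳ 1#
  sumOver-weight xs w (ℕ.suc k) Σw≈1 = begin
    sumOver (vectors xs (ℕ.suc k)) (weight w)
      ≈⟨ sumOver-vectors-suc xs (vectors xs k) (weight w) ⟩
    sumOver xs (λ x → sumOver (vectors xs k) λ t → w x * weight w t)
      ≈⟨ sumOver-cong xs (λ x → sumOver-*ˡ (vectors xs k) (w x) (weight w)) ⟩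
    sumOver xs (λ x → w x * sumOver (vectors xs k) (weight w))
      ≈⟨ sumOver-*ʳ xs w _ ⟩
    sumOver xs w * sumOver (vectors xs k) (weight w)
      ≈⟨ *-cong Σw≈1 (sumOver-weight xs w k Σw≈1) ⟩
    1# * 1#
      ≈⟨ *-identityˡ 1# ⟩
    1# ∎

  module _ (_≟_ : DecidableEquality B) where

    point : B → Carrier → B → Carrier
    point b a y = if does (b ≟ y) then a else 0#

    sumOver-point-∉ : ∀ {b} {ys : List B} a → All (λ y → ¬ b ≡ y) ys → sumOver ys (point b a) ≈ 0#
    sumOver-point-∉ a [] = refl
    sumOver-point-∉ {b} {y ∷ ys} a (b≢y ∷ b∉ys) with b ≟ y
    ... | yes b≡y = contradiction b≡y b≢y
    ... | no  _   = trans (+-identityˡ _) (sumOver-point-∉ a b∉ys)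

    sumOver-point : ∀ {b} {ys : List B} a → Unique ys → b ∈ˡ ys → sumOver ys (point b a) ≈ a
    sumOver-point {b} {y ∷ ys} a (y∉ys ∷ u) b∈ys with b ≟ y | b∈ys
    ... | yes ≡.refl | _          = trans (+-congˡ (sumOver-point-∉ a y∉ys)) (+-identityʳ a)
    ... | no b≢y     | here b≡y   = contradiction b≡y b≢y
    ... | no _       | there b∈ys = trans (+-identityˡ _) (sumOver-point a u b∈ys)

    sumOver-fibres : ∀ {ys : List B} → Unique ys → (∀ b → b ∈ˡ ys) → (f : A → B) (w : A → Carrier) →
      ∀ xs → sumOver ys (λ y → sumOver (filter (λ x → f x ≟ y) xs) w) ≈ sumOver xs w
    sumOver-fibres {ys = ys} u all f w []       = sumOver-0 ys
    sumOver-fibres {ys = ys} u all f w (x ∷ xs) = begin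
      sumOver ys (λ y → sumOver (filter (λ x → f x ≟ y) (x ∷ xs)) w)
        ≈⟨ sumOver-cong ys split ⟩
      sumOver ys (λ y → point (f x) (w x) y + sumOver (filter (λ x → f x ≟ y) xs) w)
        ≈⟨ sumOver-+ ys _ _ ⟩
      sumOver ys (point (f x) (w x)) + sumOver ys (λ y → sumOver (filter (λ x → f x ≟ y) xs) w)
        ≈⟨ +-cong (sumOver-point (w x) u (all (f x))) (sumOver-fibres u all f w xs) ⟩
      w x + sumOver xs w ∎
      where
      split : ∀ y → sumOver (filter (λ x → f x ≟ y) (x ∷ xs)) w ≈
                    point (f x) (w x) y + sumOver (filter (λ x → f x ≟ y) xs) w
      split y with does (f x ≟ y)
      ... | true  = refl
      ... | false = sym (+-identityˡ _)

  -- The prior μᵏ: the law of the set of values of k independent draws from μ.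
  -- Repeated draws coincide, so the set may have fewer than k elements.

  iid : ItemDistribution N → ∀ k → Prior N
  iid {N} μ k = record
    { mass    = iidMass (mass μ) k
    ; nonNeg  = λ S → sumOver-nonNegative (filter (λ t → itemSet t ≟ˢ S) (vectors (allFin N) k))
                                          (weight-nonNegative (nonNeg μ))
    ; total≈1 = trans (sumOver-fibres _≟ˢ_ (subsets-unique N) ∈-subsets itemSet (weight (mass μ))
                                       (vectors (allFin N) k))
                      (sumOver-weight (allFin N) (mass μ) k (total≈1 μ))
    }

  _SupportedOn_ : ItemDistribution N → Subset N → Set ℓ₃
  μ SupportedOn M = ∀ i → 0# < mass μ i → i ∈ M

  SupportedOn2k : ∀ {N} → ℕ → ItemDistribution N → Set ℓ₃
  SupportedOn2k k μ = ∃[ M ] ((∣ M ∣ ≡ 2 ℕ.* k) × (μ SupportedOn M))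

  data Family (N k : ℕ) : Prior N → Set (c ⊔ ℓ₁ ⊔ ℓ₃) where
    family : (μ : ItemDistribution N) → SupportedOn2k k μ → Family N k (iid μ k)

  record Scheme (N m : ℕ) : Set (c ⊔ ℓ₁ ⊔ ℓ₃) where
    field
      Enc : Subset N → Vec Bool m
      Dec : Prior N → Vec Bool m → Subset N

  HandlesWithoutError : Scheme N m → Prior N → Set ℓ₁
  HandlesWithoutError s σ = Pr σ (λ S → Dec σ (Enc S) ≟ˢ S) ≈ 1#
    where open Scheme s

  m* : ℕ → ItemDistribution N → Carrier
  m* k μ = fromℕ k * H μ

  lg[_/_] : (N k : ℕ) .{{_ : NonZero N}} .{{_ : NonZero k}} → Carrier
  lg[ N / k ] = lg (fromℕ⁺ N /⁺ fromℕ⁺ k)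

  lg[2*_] : (k : ℕ) .{{_ : NonZero k}} → Carrier
  lg[2* k ] = lg (fromℕ⁺ (2 ℕ.* k) {{m*n≢0 2 k}})

{-# OPTIONS --safe #-}

-- Lower bound.  Two nonempty sets S, S′ of at most k items lie in some M with |M| = 2k, and have
-- positive mass under the uniform prior on M, so a zero-error scheme has Enc S ≢ Enc S′.  With
-- q = ⌊N / k⌋ ≥ 2 there are qᵏ transversals of k blocks of q items, hence k lg q ≤ m, while
-- N ≤ k q² gives lg (N / k) ≤ 2 lg q.  So C = 1/2 works.
--
-- Entropy.  Put ℓ = lg (1 + h).  Comparing x with x (1 + h) shows h lg x + ℓ ≤ ℓ (x + h) for all
-- x > 0.  Taking x = 1 / (2k μ(i)), multiplying by μ(i) and summing gives H(μ) ≤ lg (2k) + ℓ,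
-- and ℓ is arbitrarily small.

module Submission where

open import Defs
open import Algebra.Bundles using (CommutativeRing)
import Algebra.Properties.AbelianGroup as AbelianGroupProperties
import Algebra.Properties.Semiring.Mult as SemiringMult
import Algebra.Solver.Ring.NaturalCoefficients.Default as SemiringSolver
open import Data.Bool.Base using (Bool; true; false; if_then_else_)
open import Data.Fin.Base using (Fin; zero; suc; combine; inject≤; finToFun; funToFin)
import Data.Fin.Properties as Fin
open import Data.Fin.Subset using (Subset; inside; outside; ⁅_⁆; ⊤; _∪_; ∣_∣; _∈_; _⊆_)
open import Data.Fin.Subset.Properties
  using (⊆⊤; ∣⊤∣≡n; s⊆s; p⊆p∪q; q⊆p∪q; x∈p∪q⁻; x∈p∪q⁺; x∈⁅x⁆; x∈⁅y⁆⇒x≡y; ∉⊥; ∣⁅x⁆∣≡1; ∣⊥∣≡0)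
open import Data.List.Base as List using (List; []; _∷_; allFin; filter; tabulate)
open import Data.List.Membership.Propositional using () renaming (_∈_ to _∈ˡ_)
open import Data.List.Membership.Propositional.Properties using (∈-filter⁺; ∈-allFin)
import Data.List.Properties as List
open import Data.List.Relation.Unary.Any using (here; there)
open import Data.Nat.Base as ℕ using (ℕ; zero; suc; NonZero)
open import Data.Nat.DivMod using (_/_; m≡m%n+[m/n]*n; m%n<n; m/n*n≤m; /-monoˡ-≤; m*n/n≡m)
import Data.Nat.Properties as ℕ
open import Data.Product.Base using (∃-syntax; _×_; _,_; proj₁; proj₂)
open import Data.Sum.Base using (inj₁; inj₂; [_,_]′)
open import Data.Vec.Base as Vec using (Vec; []; _∷_; lookup)
open import Data.Vec.Membership.Propositional using () renaming (_∈_ to _∈ᵛ_)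
open import Data.Vec.Membership.Propositional.Properties using (∈-tabulate⁺)
import Data.Vec.Properties as Vec
open import Data.Vec.Relation.Unary.Any as VecAny using ()
import Data.Vec.Relation.Unary.Any.Properties as VecAny
open import Function.Base using (_∘_)
open import Function.Bundles using (Inverse)
open import Relation.Binary.Definitions using (Trans)
open import Relation.Binary.PropositionalEquality as ≡ using (_≡_; _≗_)
import Relation.Binary.Reasoning.Base.Triple as Triple
open import Relation.Binary.Structures using (IsPreorder; IsStrictPartialOrder)
open import Relation.Nullary using (¬_; contradiction; does)
open import Relation.Nullary.Decidable using (decidable-stable)
open import Relation.Unary using (Pred; Decidable)
open import Relation.Unary.Properties using (∁?)

private variable
  N k m n : ℕ

-- Finite sets: size of unions, padding to a given size, and item sets of tuples.

∣p∪q∣≤∣p∣+∣q∣ : (p q : Subset N) → ∣ p ∪ q ∣ ℕ.≤ ∣ p ∣ ℕ.+ ∣ q ∣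
∣p∪q∣≤∣p∣+∣q∣ []            []            = ℕ.z≤n
∣p∪q∣≤∣p∣+∣q∣ (outside ∷ p) (outside ∷ q) = ∣p∪q∣≤∣p∣+∣q∣ p q
∣p∪q∣≤∣p∣+∣q∣ (outside ∷ p) (inside  ∷ q) =
  ℕ.≤-trans (ℕ.s≤s (∣p∪q∣≤∣p∣+∣q∣ p q)) (ℕ.≤-reflexive (≡.sym (ℕ.+-suc ∣ p ∣ ∣ q ∣)))
∣p∪q∣≤∣p∣+∣q∣ (inside  ∷ p) (outside ∷ q) = ℕ.s≤s (∣p∪q∣≤∣p∣+∣q∣ p q)
∣p∪q∣≤∣p∣+∣q∣ (inside  ∷ p) (inside  ∷ q) =
  ℕ.s≤s (ℕ.≤-trans (∣p∪q∣≤∣p∣+∣q∣ p q) (ℕ.+-monoʳ-≤ ∣ p ∣ (ℕ.n≤1+n ∣ q ∣)))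

-- Pads a small set to the exact size `2k` that the family of priors asks for. A position outside
-- `p` stays outside as long as the remaining `N` positions can hold `n` elements; otherwise `n` is
-- the full size and `⊤` is taken.
superset-of-size : ∀ {n} (p : Subset N) → ∣ p ∣ ℕ.≤ n → n ℕ.≤ N → ∃[ q ] (p ⊆ q × ∣ q ∣ ≡ n)
superset-of-size []           _           ℕ.z≤n       = [] , (λ ()) , ≡.refl
superset-of-size (inside ∷ p) (ℕ.s≤s ∣p∣≤n) (ℕ.s≤s n≤N) =
  let (q , p⊆q , ∣q∣≡n) = superset-of-size p ∣p∣≤n n≤N in inside ∷ q , s⊆s p⊆q , ≡.cong suc ∣q∣≡n
superset-of-size {suc N} {n} (outside ∷ p) ∣p∣≤n n≤1+N with ℕ.m≤n⇒m<n∨m≡n n≤1+N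
... | inj₁ (ℕ.s≤s n≤N) =
  let (q , p⊆q , ∣q∣≡n) = superset-of-size p ∣p∣≤n n≤N in outside ∷ q , s⊆s p⊆q , ∣q∣≡n
... | inj₂ ≡.refl      = ⊤ , ⊆⊤ , ∣⊤∣≡n (suc N)

∈-itemSet⁺ : ∀ {i} {t : Vec (Fin N) k} → i ∈ᵛ t → i ∈ itemSet t
∈-itemSet⁺ {i = i} (VecAny.here ≡.refl) = x∈p∪q⁺ (inj₁ (x∈⁅x⁆ i))
∈-itemSet⁺         (VecAny.there i∈t)   = x∈p∪q⁺ (inj₂ (∈-itemSet⁺ i∈t))

∈-itemSet⁻ : ∀ {i} (t : Vec (Fin N) k) → i ∈ itemSet t → i ∈ᵛ t
∈-itemSet⁻ []      i∈⊥  = contradiction i∈⊥ ∉⊥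
∈-itemSet⁻ (x ∷ t) i∈x∪t with x∈p∪q⁻ ⁅ x ⁆ (itemSet t) i∈x∪t
... | inj₁ i∈x = VecAny.here (x∈⁅y⁆⇒x≡y x i∈x)
... | inj₂ i∈t = VecAny.there (∈-itemSet⁻ t i∈t)

∣itemSet∣≤ : (t : Vec (Fin N) k) → ∣ itemSet t ∣ ℕ.≤ k
∣itemSet∣≤ {N} []  = ℕ.≤-reflexive (∣⊥∣≡0 N)
∣itemSet∣≤ (x ∷ t) = ℕ.≤-trans (∣p∪q∣≤∣p∣+∣q∣ ⁅ x ⁆ (itemSet t))
                               (ℕ.+-mono-≤ (ℕ.≤-reflexive (∣⁅x⁆∣≡1 x)) (∣itemSet∣≤ t))

-- Transversals of `k` disjoint blocks, and counting them by codewords.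

transversal : k ℕ.* n ℕ.≤ N → (Fin k → Fin n) → Vec (Fin N) k
transversal kn≤N a = Vec.tabulate λ j → inject≤ (combine j (a j)) kn≤N

-- `combine j (a j)` is the element at offset `a j` of the `j`-th block of `n` items. An item
-- therefore determines its block and its offset: the item chosen by `a` in block `j` can only be
-- the one chosen by `b` in the same block. Hence the unordered set already determines the choice
-- function.
transversal-injective : (kn≤N : k ℕ.* n ℕ.≤ N) (a b : Fin k → Fin n) →
  itemSet (transversal kn≤N a) ≡ itemSet (transversal kn≤N b) → a ≗ b
transversal-injective kn≤N a b eq j
  with VecAny.tabulate⁻ (∈-itemSet⁻ (transversal kn≤N b)
         (≡.subst (_ ∈_) eq (∈-itemSet⁺ (∈-tabulate⁺ (λ j → inject≤ (combine j (a j)) kn≤N) j))))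
... | i , ja≡ib with Fin.combine-injective j (a j) i (b i) (Fin.inject≤-injective kn≤N kn≤N _ _ ja≡ib)
... | ≡.refl , aj≡bj = aj≡bj

lookup-ext : ∀ {A : Set} (v w : Vec A m) → lookup v ≗ lookup w → v ≡ w
lookup-ext v w v≗w =
  ≡.trans (≡.sym (Vec.tabulate∘lookup v)) (≡.trans (Vec.tabulate-cong v≗w) (Vec.tabulate∘lookup w))

functions≤words : (f : (Fin k → Fin n) → Vec Bool m) → (∀ a b → f a ≡ f b → a ≗ b) → n ℕ.^ k ℕ.≤ 2 ℕ.^ m
functions≤words {k} {n} {m} f f-injective = Fin.injective⇒≤ {f = toWord ∘ f ∘ finToFun} injective
  where
  open Inverse Fin.2↔Bool using (from; strictlyInverseˡ; to)

  toWord : Vec Bool m → Fin (2 ℕ.^ m)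
  toWord v = funToFin (from ∘ lookup v)

  toWord-injective : ∀ v w → toWord v ≡ toWord w → v ≡ w
  toWord-injective v w eq = lookup-ext v w λ i →
    ≡.trans (≡.sym (strictlyInverseˡ (lookup v i))) (≡.trans (≡.cong to (begin
      from (lookup v i)    ≡⟨ Fin.finToFun-funToFin (from ∘ lookup v) i ⟨
      finToFun (toWord v) i ≡⟨ ≡.cong (λ x → finToFun x i) eq ⟩
      finToFun (toWord w) i ≡⟨ Fin.finToFun-funToFin (from ∘ lookup w) i ⟩
      from (lookup w i)    ∎)) (strictlyInverseˡ (lookup w i)))
    where open ≡.≡-Reasoning

  -- Takes the place of function extensionality in `injective`.
  funToFin-cong : ∀ {k} {a b : Fin k → Fin n} → a ≗ b → funToFin a ≡ funToFin b
  funToFin-cong {zero}  a≗b = ≡.refl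
  funToFin-cong {suc k} a≗b = ≡.cong₂ combine (a≗b zero) (funToFin-cong (a≗b ∘ suc))

  injective : ∀ {x y} → toWord (f (finToFun x)) ≡ toWord (f (finToFun y)) → x ≡ y
  injective {x} {y} eq = begin
    x                             ≡⟨ Fin.funToFin-finToFin {k} {n} x ⟨
    funToFin (finToFun {n} {k} x) ≡⟨ funToFin-cong (f-injective _ _ (toWord-injective _ _ eq)) ⟩
    funToFin (finToFun {n} {k} y) ≡⟨ Fin.funToFin-finToFin {k} {n} y ⟩
    y                             ∎
    where open ≡.≡-Reasoning

-- Arithmetic of the quotient `q = N / k`.

2≤N/k : ∀ N k .{{_ : NonZero k}} → 2 ℕ.* k ℕ.≤ N → 2 ℕ.≤ N / k
2≤N/k N k 2k≤N = ≡.subst (ℕ._≤ N / k) (m*n/n≡m 2 k) (/-monoˡ-≤ k 2k≤N)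

-- The remainder is less than `k`, so `N` is at most `(1 + q) k`; two uses of `q ≥ 2` raise the
-- factor `1 + q` to `2 q` and then to `q q`.
N≤k*q*q : ∀ N k .{{_ : NonZero k}} → 2 ℕ.* k ℕ.≤ N → N ℕ.≤ k ℕ.* (N / k ℕ.* (N / k))
N≤k*q*q N k 2k≤N = begin
  N                            ≡⟨ m≡m%n+[m/n]*n N k ⟩
  N ℕ.% k ℕ.+ q ℕ.* k          ≤⟨ ℕ.+-monoˡ-≤ (q ℕ.* k) (ℕ.<⇒≤ (m%n<n N k)) ⟩
  (1 ℕ.+ q) ℕ.* k              ≤⟨ ℕ.*-monoˡ-≤ k (ℕ.+-monoˡ-≤ q (ℕ.<⇒≤ 2≤q)) ⟩
  (q ℕ.+ q) ℕ.* k              ≡⟨ ≡.cong (λ x → (q ℕ.+ x) ℕ.* k) (ℕ.+-identityʳ q) ⟨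
  (2 ℕ.* q) ℕ.* k              ≤⟨ ℕ.*-monoˡ-≤ k (ℕ.*-monoˡ-≤ q 2≤q) ⟩
  (q ℕ.* q) ℕ.* k              ≡⟨ ℕ.*-comm (q ℕ.* q) k ⟩
  k ℕ.* (q ℕ.* q)              ∎
  where
  open ℕ.≤-Reasoning

  q : ℕ
  q = N / k

  2≤q : 2 ℕ.≤ q
  2≤q = 2≤N/k N k 2k≤N

-- Order and arithmetic in a constructive ordered field.

module OrderedField {c ℓ₁ ℓ₂ ℓ₃} (ℝ : RealNumbers c ℓ₁ ℓ₂ ℓ₃) where
  open RealNumbers ℝ
  open Positive ℝ
  open CommutativeRing commutativeRing using (+-abelianGroup; semiring; commutativeSemiring)
  open IsStrictPartialOrder <-isStrictPartialOrder using (<-resp-≈; asym)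
  open AbelianGroupProperties +-abelianGroup using (\\-leftDividesˡ; \\-leftDividesʳ)
  open SemiringMult semiring using (×1-homo-*)
  open SemiringSolver commutativeSemiring using (solve; _:+_; _:*_; _:=_)

  private variable w x y z : Carrier

  -- Since `y ≤ z` is only a negation, no comparison can be read off from it. Cotransitivity of
  -- apartness sets `z` apart from `x` or from `y`, and the hypotheses exclude the wrong direction
  -- in either case.
  <-≤-trans : Trans _<_ _≤_ _<_
  <-≤-trans {x} {y} {z} x<y y≤z with #-cotrans (<⇒# x<y) z
  ... | inj₁ x#z = [ (λ x<z → x<z) , (λ z<x → contradiction (<-trans z<x x<y) y≤z) ]′ (#⇒<⊎> x#z)
  ... | inj₂ z#y = [ (λ z<y → contradiction z<y y≤z) , <-trans x<y ]′ (#⇒<⊎> z#y)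

  ≤-<-trans : Trans _≤_ _<_ _<_
  ≤-<-trans {x} {y} {z} x≤y y<z with #-cotrans (<⇒# y<z) x
  ... | inj₁ y#x = [ (λ y<x → contradiction y<x x≤y) , (λ x<y → <-trans x<y y<z) ]′ (#⇒<⊎> y#x)
  ... | inj₂ x#z = [ (λ x<z → x<z) , (λ z<x → contradiction (<-trans y<z z<x) x≤y) ]′ (#⇒<⊎> x#z)

  ≤-isPreorder : IsPreorder _≈_ _≤_
  ≤-isPreorder = record
    { isEquivalence = isEquivalence
    ; reflexive     = λ x≈y y<x → <-irrefl (sym x≈y) y<x
    ; trans         = λ x≤y y≤z z<x → y≤z (<-≤-trans z<x x≤y)
    }

  open IsPreorder ≤-isPreorder public
    using () renaming (refl to ≤-refl; reflexive to ≤-reflexive; trans to ≤-trans)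

  module ≤-Reasoning = Triple ≤-isPreorder asym <-trans <-resp-≈ asym <-≤-trans ≤-<-trans

  ≤-antisym : x ≤ y → y ≤ x → x ≈ y
  ≤-antisym {x} {y} x≤y y≤x = proj₁ (tight x y) ([ y≤x , x≤y ]′ ∘ #⇒<⊎>)

  -- The goal is a negation, so the order may be treated as decidable.
  ≤-by-cases : ∀ x y → (x < y → w ≤ z) → (y ≤ x → w ≤ z) → w ≤ z
  ≤-by-cases x y if-< if-≥ z<w = if-≥ (λ x<y → if-< x<y z<w) z<w

  +-cancelˡ-< : ∀ z → z + x < z + y → x < y
  +-cancelˡ-< z = <-respˡ-≈ (\\-leftDividesʳ z _) ∘ <-respʳ-≈ (\\-leftDividesʳ z _) ∘ +-monoʳ-< (- z)

  -- As `≤` is a negated `<`, monotonicity for `≤` is the contrapositive of cancellation for `<`,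
  -- and cancellation for `≤` that of monotonicity for `<`. The multiplicative versions below follow
  -- the same pattern.
  +-monoʳ-≤ : ∀ z → x ≤ y → z + x ≤ z + y
  +-monoʳ-≤ z x≤y = x≤y ∘ +-cancelˡ-< z

  +-monoˡ-≤ : ∀ z → x ≤ y → x + z ≤ y + z
  +-monoˡ-≤ z x≤y = x≤y ∘ +-cancelˡ-< z ∘ <-respˡ-≈ (+-comm _ z) ∘ <-respʳ-≈ (+-comm _ z)

  +-mono-≤ : w ≤ x → y ≤ z → w + y ≤ x + z
  +-mono-≤ w≤x y≤z = ≤-trans (+-monoˡ-≤ _ w≤x) (+-monoʳ-≤ _ y≤z)

  +-cancelʳ-≤ : ∀ z → x + z ≤ y + z → x ≤ y
  +-cancelʳ-≤ z x+z≤y+z =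
    x+z≤y+z ∘ <-respˡ-≈ (+-comm z _) ∘ <-respʳ-≈ (+-comm z _) ∘ +-monoʳ-< z

  -- The axioms speak only of products of positive numbers, so `*-pos` is applied to `z` and the
  -- difference `- x + y`.
  *-monoʳ-< : 0# < z → x < y → z * x < z * y
  *-monoʳ-< {z} {x} {y} 0<z x<y =
    <-respˡ-≈ (+-identityʳ (z * x)) (<-respʳ-≈ zx+z[-x+y]≈zy (+-monoʳ-< (z * x) (*-pos 0<z 0<-x+y)))
    where
    0<-x+y : 0# < - x + y
    0<-x+y = <-respˡ-≈ (-‿inverseˡ x) (+-monoʳ-< (- x) x<y)

    zx+z[-x+y]≈zy : z * x + z * (- x + y) ≈ z * y
    zx+z[-x+y]≈zy = trans (sym (distribˡ z x (- x + y))) (*-congˡ (\\-leftDividesˡ x y))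

  *-cancelˡ-< : 0# < z → z * x < z * y → x < y
  *-cancelˡ-< {z} {x} {y} 0<z zx<zy with reciprocal 0<z
  ... | z⁻¹ , zz⁻¹≈1 , 0<z⁻¹ = <-respˡ-≈ (cancel x) (<-respʳ-≈ (cancel y) (*-monoʳ-< 0<z⁻¹ zx<zy))
    where
    cancel : ∀ x → z⁻¹ * (z * x) ≈ x
    cancel x = trans (solve 3 (λ a b c → a :* (b :* c) := (b :* a) :* c) refl z⁻¹ z x)
                     (trans (*-congʳ zz⁻¹≈1) (*-identityˡ x))

  *-monoʳ-≤ : 0# < z → x ≤ y → z * x ≤ z * y
  *-monoʳ-≤ 0<z x≤y = x≤y ∘ *-cancelˡ-< 0<z

  *-cancelˡ-≤ : 0# < z → z * x ≤ z * y → x ≤ y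
  *-cancelˡ-≤ 0<z zx≤zy = zx≤zy ∘ *-monoʳ-< 0<z

  fromℕ-homo-* : ∀ m n → fromℕ (m ℕ.* n) ≈ fromℕ m * fromℕ n
  fromℕ-homo-* = ×1-homo-*

  fromℕ-suc-* : ∀ n x → fromℕ (suc n) * x ≈ x + fromℕ n * x
  fromℕ-suc-* n x = trans (distribʳ x 1# (fromℕ n)) (+-congʳ (*-identityˡ x))

  0≤fromℕ : ∀ n → 0# ≤ fromℕ n
  0≤fromℕ zero    = ≤-refl
  0≤fromℕ (suc n) = asym (proj₂ (fromℕ⁺ (suc n)))

  fromℕ-mono-< : ∀ {m n} → m ℕ.< n → fromℕ m < fromℕ n
  fromℕ-mono-< {zero}  {suc n} _           = proj₂ (fromℕ⁺ (suc n))
  fromℕ-mono-< {suc m} {suc n} (ℕ.s≤s m<n) = +-monoʳ-< 1# (fromℕ-mono-< m<n)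

  fromℕ-mono-≤ : ∀ {m n} → m ℕ.≤ n → fromℕ m ≤ fromℕ n
  fromℕ-mono-≤ m≤n = [ asym ∘ fromℕ-mono-< , (λ { ≡.refl → ≤-refl }) ]′ (ℕ.m≤n⇒m<n∨m≡n m≤n)

  fromℕ⁺≈fromℕ : ∀ n .{{_ : NonZero n}} → proj₁ (fromℕ⁺ n) ≈ fromℕ n
  fromℕ⁺≈fromℕ (suc n) = refl

  0<fromℕ : ∀ n .{{_ : NonZero n}} → 0# < fromℕ n
  0<fromℕ n = <-respʳ-≈ (fromℕ⁺≈fromℕ n) (proj₂ (fromℕ⁺ n))

  *-1/⁺ : ∀ p → proj₁ p * proj₁ (1/⁺ p) ≈ 1#
  *-1/⁺ (x , 0<x) = proj₁ (proj₂ (reciprocal 0<x))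

  /⁺-* : ∀ p q → proj₁ ((p /⁺ q) *⁺ q) ≈ proj₁ p
  /⁺-* p q = trans (solve 3 (λ a b c → (a :* b) :* c := a :* (c :* b)) refl (proj₁ p) _ (proj₁ q))
                   (trans (*-congˡ (*-1/⁺ q)) (*-identityʳ (proj₁ p)))

  archimedean-* : ∀ x → 0# < y → ∃[ n ] x < fromℕ n * y
  archimedean-* {y} x 0<y with reciprocal 0<y
  ... | y⁻¹ , yy⁻¹≈1 , _ with archimedean (x * y⁻¹)
  ... | n , xy⁻¹<n = n , <-respˡ-≈ yxy⁻¹≈x (<-respʳ-≈ (*-comm y _) (*-monoʳ-< 0<y xy⁻¹<n))
    where
    yxy⁻¹≈x : y * (x * y⁻¹) ≈ x
    yxy⁻¹≈x = trans (solve 3 (λ a b c → a :* (b :* c) := b :* (a :* c)) refl y x y⁻¹)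
                    (trans (*-congˡ yy⁻¹≈1) (*-identityʳ x))

-- The binary logarithm: a secant bound, and smallness of `lg (1 + h)`.

module Logarithm {c ℓ₁ ℓ₂ ℓ₃} (ℝ : RealNumbers c ℓ₁ ℓ₂ ℓ₃) (logarithm : BinaryLogarithm ℝ) where
  open RealNumbers ℝ
  open Positive ℝ
  open BinaryLogarithm logarithm
  open OrderedField ℝ
  open IsStrictPartialOrder <-isStrictPartialOrder using (asym)
  open CommutativeRing commutativeRing using (commutativeSemiring; +-group)
  open SemiringSolver commutativeSemiring using (solve; _:+_; _:*_; _:=_)
  open ≤-Reasoning

  lg-mono-≤ : ∀ p q → proj₁ p ≤ proj₁ q → lg p ≤ lg q
  lg-mono-≤ p q p≤q = ≤-by-cases (proj₁ p) (proj₁ q)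
    (λ p<q → asym (lg-mono-< p q p<q))
    (λ q≤p → ≤-reflexive (lg-cong p q (≤-antisym p≤q q≤p)))

  lg-cancel-≤ : ∀ p q → lg p ≤ lg q → proj₁ p ≤ proj₁ q
  lg-cancel-≤ p q lgp≤lgq = lgp≤lgq ∘ lg-mono-< q p

  1⁺ : ℝ⁺
  1⁺ = 1# , 0<1

  lg-1 : lg 1⁺ ≈ 0#
  lg-1 = identityˡ-unique (lg 1⁺) (lg 1⁺)
    (trans (sym (lg-* 1⁺ 1⁺)) (lg-cong (1⁺ *⁺ 1⁺) 1⁺ (*-identityˡ 1#)))
    where open import Algebra.Properties.Group +-group using (identityˡ-unique)

  lg-/ : ∀ p q → lg (p /⁺ q) + lg q ≈ lg p
  lg-/ p q = trans (sym (lg-* (p /⁺ q) q)) (lg-cong ((p /⁺ q) *⁺ q) p (/⁺-* p q))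

  1+⁺_ : ℝ⁺ → ℝ⁺
  1+⁺ (h , 0<h) = 1# + h , +-pos 0<1 0<h

  1<1+⁺ : ∀ h → 1# < proj₁ (1+⁺ h)
  1<1+⁺ (h , 0<h) = <-respˡ-≈ (+-identityʳ 1#) (+-monoʳ-< 1# 0<h)

  lg-1+-pos : ∀ h → 0# < lg (1+⁺ h)
  lg-1+-pos h = <-respˡ-≈ lg-1 (lg-mono-< 1⁺ (1+⁺ h) (1<1+⁺ h))

  -- The secant line through 1 and 1 + h, raised by ℓ, lies above the logarithm.  Below states this
  -- multiplied by h, without subtraction.
  module Secant (h⁺ : ℝ⁺) where
    h ℓ : Carrier
    h = proj₁ h⁺
    ℓ = lg (1+⁺ h⁺)

    a : ℝ⁺
    a = 1+⁺ h⁺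

    0<h : 0# < h
    0<h = proj₂ h⁺

    0<ℓ : 0# < ℓ
    0<ℓ = lg-1+-pos h⁺

    Below : ℝ⁺ → Set ℓ₃
    Below x = h * lg x + ℓ ≤ ℓ * (proj₁ x + h)

    below-cong : ∀ x y → proj₁ x ≈ proj₁ y → Below x → Below y
    below-cong x y x≈y below-x = begin
      h * lg y + ℓ      ≈⟨ +-congʳ (*-congˡ (lg-cong x y x≈y)) ⟨
      h * lg x + ℓ      ≤⟨ below-x ⟩
      ℓ * (proj₁ x + h) ≈⟨ *-congˡ (+-congʳ x≈y) ⟩
      ℓ * (proj₁ y + h) ∎

    -- Raising the secant by `ℓ` leaves enough room on `[1, a]` for the crude bound of `lg x` by its
    -- value `ℓ` at the right end.
    below-base : ∀ x → 1# ≤ proj₁ x → proj₁ x ≤ proj₁ a → Below x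
    below-base x 1≤x x≤a = begin
      h * lg x + ℓ            ≤⟨ +-monoˡ-≤ ℓ (*-monoʳ-≤ 0<h (lg-mono-≤ x a x≤a)) ⟩
      h * ℓ + ℓ               ≈⟨ +-congˡ (*-identityʳ ℓ) ⟨
      h * ℓ + ℓ * 1#          ≤⟨ +-monoʳ-≤ (h * ℓ) (*-monoʳ-≤ 0<ℓ 1≤x) ⟩
      h * ℓ + ℓ * proj₁ x     ≈⟨ solve 3 (λ h ℓ x → h :* ℓ :+ ℓ :* x := ℓ :* (x :+ h)) refl h ℓ (proj₁ x) ⟩
      ℓ * (proj₁ x + h)       ∎

    lg-shift : ∀ x → h * lg (x *⁺ a) + ℓ ≈ (h * lg x + ℓ) + h * ℓ
    lg-shift x = trans (+-congʳ (*-congˡ (lg-* x a)))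
      (solve 3 (λ h ℓ l → h :* (l :+ ℓ) :+ ℓ := (h :* l :+ ℓ) :+ h :* ℓ) refl h ℓ (lg x))

    secant-shift : ∀ x → ℓ * (proj₁ (x *⁺ a) + h) ≈ ℓ * (proj₁ x + h) + h * ℓ * proj₁ x
    secant-shift (x , _) =
      trans (*-congˡ (+-congʳ (trans (distribˡ x 1# h) (+-congʳ (*-identityʳ x)))))
            (solve 3 (λ h ℓ x → ℓ :* ((x :+ x :* h) :+ h) := ℓ :* (x :+ h) :+ (h :* ℓ) :* x) refl h ℓ x)

    0<hℓ : 0# < h * ℓ
    0<hℓ = *-pos 0<h 0<ℓ

    -- Passing from `x` to `x a` adds `h ℓ` to the left side and `h ℓ x` to the right side. For
    -- `x ≥ 1` the right side gains at least as much; for `x ≤ 1` the same comparison gives the way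
    -- back in `below-down`.
    below-up : ∀ x → 1# ≤ proj₁ x → Below x → Below (x *⁺ a)
    below-up x 1≤x below-x = begin
      h * lg (x *⁺ a) + ℓ                   ≈⟨ lg-shift x ⟩
      (h * lg x + ℓ) + h * ℓ                ≈⟨ +-congˡ (*-identityʳ (h * ℓ)) ⟨
      (h * lg x + ℓ) + h * ℓ * 1#           ≤⟨ +-mono-≤ below-x (*-monoʳ-≤ 0<hℓ 1≤x) ⟩
      ℓ * (proj₁ x + h) + h * ℓ * proj₁ x   ≈⟨ secant-shift x ⟨
      ℓ * (proj₁ (x *⁺ a) + h)              ∎

    below-down : ∀ x → proj₁ x ≤ 1# → Below (x *⁺ a) → Below x
    below-down x x≤1 below-xa = +-cancelʳ-≤ (h * ℓ) (begin
      (h * lg x + ℓ) + h * ℓ                ≈⟨ lg-shift x ⟨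
      h * lg (x *⁺ a) + ℓ                   ≤⟨ below-xa ⟩
      ℓ * (proj₁ (x *⁺ a) + h)              ≈⟨ secant-shift x ⟩
      ℓ * (proj₁ x + h) + h * ℓ * proj₁ x   ≤⟨ +-monoʳ-≤ _ (*-monoʳ-≤ 0<hℓ x≤1) ⟩
      ℓ * (proj₁ x + h) + h * ℓ * 1#        ≈⟨ +-congˡ (*-identityʳ (h * ℓ)) ⟩
      ℓ * (proj₁ x + h) + h * ℓ             ∎)

    -- Each division by `a` lowers the logarithm by `ℓ`, so at most `r` divisions bring `x` into
    -- `[1, a]`; `below-up` then climbs back.
    below-above-1 : ∀ r x → 1# ≤ proj₁ x → lg x ≤ fromℕ r * ℓ → Below x
    -- Here `lg x ≤ 0` forces `x ≤ 1`, so `x` is already in the base interval.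
    below-above-1 zero x 1≤x lgx≤0 = below-base x 1≤x (≤-trans x≤1 (asym (1<1+⁺ h⁺)))
      where
      x≤1 : proj₁ x ≤ 1#
      x≤1 = lg-cancel-≤ x 1⁺ (≤-trans lgx≤0 (≤-reflexive (trans (zeroˡ ℓ) (sym lg-1))))
    below-above-1 (suc r) x 1≤x lgx≤ = ≤-by-cases (proj₁ a) (proj₁ x)
      (λ a<x → below-cong ((x /⁺ a) *⁺ a) x (/⁺-* x a)
                 (below-up (x /⁺ a) (1≤x/a a<x) (below-above-1 r (x /⁺ a) (1≤x/a a<x) lg[x/a]≤)))
      (below-base x 1≤x)
      where
      1≤x/a : proj₁ a < proj₁ x → 1# ≤ proj₁ (x /⁺ a)
      1≤x/a a<x = *-cancelˡ-≤ (proj₂ a) (begin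
        proj₁ a * 1#             ≈⟨ *-identityʳ (proj₁ a) ⟩
        proj₁ a                  <⟨ a<x ⟩
        proj₁ x                  ≈⟨ /⁺-* x a ⟨
        proj₁ (x /⁺ a) * proj₁ a ≈⟨ *-comm _ _ ⟩
        proj₁ a * proj₁ (x /⁺ a) ∎)

      lg[x/a]≤ : lg (x /⁺ a) ≤ fromℕ r * ℓ
      lg[x/a]≤ = +-cancelʳ-≤ ℓ (begin
        lg (x /⁺ a) + ℓ   ≈⟨ lg-/ x a ⟩
        lg x              ≤⟨ lgx≤ ⟩
        fromℕ (suc r) * ℓ ≈⟨ trans (fromℕ-suc-* r ℓ) (+-comm ℓ _) ⟩
        fromℕ r * ℓ + ℓ   ∎)

    -- The mirror image: at most `r` multiplications by `a` bring `x` up to `[1, a]`, and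
    -- `below-down` leads back.
    below-below-1 : ∀ r x → proj₁ x ≤ 1# → 0# ≤ lg x + fromℕ r * ℓ → Below x
    below-below-1 zero x x≤1 0≤lgx = below-base x 1≤x (≤-trans x≤1 (asym (1<1+⁺ h⁺)))
      where
      1≤x : 1# ≤ proj₁ x
      1≤x = lg-cancel-≤ 1⁺ x (begin
        lg 1⁺           ≈⟨ lg-1 ⟩
        0#              ≤⟨ 0≤lgx ⟩
        lg x + 0# * ℓ   ≈⟨ +-congˡ (zeroˡ ℓ) ⟩
        lg x + 0#       ≈⟨ +-identityʳ (lg x) ⟩
        lg x            ∎)
    -- The product `x a` may overshoot 1, but `x ≤ 1` keeps it at most `a`, so the base case covers
    -- it.
    below-below-1 (suc r) x x≤1 0≤ = below-down x x≤1 (≤-by-cases 1# (proj₁ (x *⁺ a))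
      (λ 1<xa → below-base (x *⁺ a) (asym 1<xa) xa≤a)
      (λ xa≤1 → below-below-1 r (x *⁺ a) xa≤1 0≤lg[xa]))
      where
      xa≤a : proj₁ (x *⁺ a) ≤ proj₁ a
      xa≤a = begin
        proj₁ x * proj₁ a ≈⟨ *-comm _ _ ⟩
        proj₁ a * proj₁ x ≤⟨ *-monoʳ-≤ (proj₂ a) x≤1 ⟩
        proj₁ a * 1#      ≈⟨ *-identityʳ (proj₁ a) ⟩
        proj₁ a           ∎

      0≤lg[xa] : 0# ≤ lg (x *⁺ a) + fromℕ r * ℓ
      0≤lg[xa] = begin
        0#                          ≤⟨ 0≤ ⟩
        lg x + fromℕ (suc r) * ℓ    ≈⟨ +-congˡ (fromℕ-suc-* r ℓ) ⟩
        lg x + (ℓ + fromℕ r * ℓ)    ≈⟨ +-assoc _ _ _ ⟨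
        (lg x + ℓ) + fromℕ r * ℓ    ≈⟨ +-congʳ (lg-* x a) ⟨
        lg (x *⁺ a) + fromℕ r * ℓ   ∎

    -- As `ℓ` is positive, the Archimedean axiom bounds `lg x` or `- lg x` by some `r ℓ`, which
    -- limits the number of shifts.
    below : ∀ x → Below x
    below x = ≤-by-cases 1# (proj₁ x) (above-1 (archimedean-* (lg x) 0<ℓ)) (below-1 (archimedean-* (- lg x) 0<ℓ))
      where
      above-1 : ∃[ r ] lg x < fromℕ r * ℓ → 1# < proj₁ x → Below x
      above-1 (r , lgx<rℓ) 1<x = below-above-1 r x (asym 1<x) (asym lgx<rℓ)

      below-1 : ∃[ r ] - lg x < fromℕ r * ℓ → proj₁ x ≤ 1# → Below x
      below-1 (r , -lgx<rℓ) x≤1 = below-below-1 r x x≤1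
        (asym (<-respˡ-≈ (-‿inverseʳ (lg x)) (+-monoʳ-< (lg x) -lgx<rℓ)))

  3*≈++ : ∀ x → fromℕ 3 * x ≈ x + (x + x)
  3*≈++ x =
    trans (fromℕ-suc-* 2 x) (+-congˡ (trans (fromℕ-suc-* 1 x) (+-congˡ
      (trans (fromℕ-suc-* 0 x) (trans (+-congˡ (zeroˡ x)) (+-identityʳ x))))))

  -- Since (1 + h / 3)² ≤ 1 + h for h ≤ 1, passing from h to h / 3 at least halves lg (1 + h).
  lg-1+-small : ∀ n → ∃[ h ] ((proj₁ h ≤ 1#) × (fromℕ (suc n) * lg (1+⁺ h) ≤ 1#))
  lg-1+-small zero = 1⁺ , ≤-refl , ≤-reflexive (begin-equality
    fromℕ 1 * lg (1+⁺ 1⁺)   ≈⟨ *-congʳ (+-identityʳ 1#) ⟩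
    1# * lg (1+⁺ 1⁺)        ≈⟨ *-identityˡ _ ⟩
    lg (1+⁺ 1⁺)             ≈⟨ lg-cong (1+⁺ 1⁺) (fromℕ⁺ 2) (+-congˡ (sym (+-identityʳ 1#))) ⟩
    lg (fromℕ⁺ 2)           ≈⟨ lg-2 ⟩
    1#                      ∎)
  lg-1+-small (suc n) = shrink (lg-1+-small n)
    where
    shrink : ∃[ h ] ((proj₁ h ≤ 1#) × (fromℕ (suc n) * lg (1+⁺ h) ≤ 1#)) →
             ∃[ h ] ((proj₁ h ≤ 1#) × (fromℕ (suc (suc n)) * lg (1+⁺ h) ≤ 1#))
    shrink (h⁺ , h≤1 , bound) = t⁺ , t≤1 , (begin
      fromℕ (suc (suc n)) * ℓ         ≈⟨ fromℕ-suc-* (suc n) ℓ ⟩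
      -- Enlarging the single `ℓ` to `(1 + n) ℓ` makes the sum `(1 + n)` copies of `2 ℓ`, to which
      -- the halving applies.
      ℓ + fromℕ (suc n) * ℓ           ≤⟨ +-monoˡ-≤ _ ℓ≤[1+n]ℓ ⟩
      fromℕ (suc n) * ℓ + fromℕ (suc n) * ℓ ≈⟨ distribˡ _ ℓ ℓ ⟨
      fromℕ (suc n) * (ℓ + ℓ)         ≤⟨ *-monoʳ-≤ (0<fromℕ (suc n)) 2ℓ≤ ⟩
      fromℕ (suc n) * lg (1+⁺ h⁺)     ≤⟨ bound ⟩
      1#                              ∎)
      where
      t⁺ : ℝ⁺
      t⁺ = h⁺ /⁺ fromℕ⁺ 3

      h t ℓ : Carrier
      h = proj₁ h⁺
      t = proj₁ t⁺
      ℓ = lg (1+⁺ t⁺)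

      t+2t≈h : t + (t + t) ≈ h
      t+2t≈h = trans (sym (3*≈++ t)) (trans (*-comm (fromℕ 3) t) (/⁺-* h⁺ (fromℕ⁺ 3)))

      t≤1 : t ≤ 1#
      t≤1 = begin
        t             ≈⟨ +-identityʳ t ⟨
        t + 0#        ≤⟨ +-monoʳ-≤ t (asym (+-pos (proj₂ t⁺) (proj₂ t⁺))) ⟩
        t + (t + t)   ≈⟨ t+2t≈h ⟩
        h             ≤⟨ h≤1 ⟩
        1#            ∎

      [1+t]²≤1+h : proj₁ ((1+⁺ t⁺) *⁺ (1+⁺ t⁺)) ≤ proj₁ (1+⁺ h⁺)
      [1+t]²≤1+h = begin
        (1# + t) * (1# + t)         ≈⟨ distribʳ (1# + t) 1# t ⟩
        1# * (1# + t) + t * (1# + t) ≈⟨ +-cong (*-identityˡ _) (trans (distribˡ t 1# t) (+-congʳ (*-identityʳ t))) ⟩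
        -- From `t ≤ 1` comes `t t ≤ t`, so the square is at most `1 + 3 t`; this is why `h` is
        -- divided by 3.
        (1# + t) + (t + t * t)      ≤⟨ +-monoʳ-≤ _ (+-monoʳ-≤ t (*-monoʳ-≤ (proj₂ t⁺) t≤1)) ⟩
        (1# + t) + (t + t * 1#)     ≈⟨ +-congˡ (+-congˡ (*-identityʳ t)) ⟩
        (1# + t) + (t + t)          ≈⟨ +-assoc 1# t _ ⟩
        1# + (t + (t + t))          ≈⟨ +-congˡ t+2t≈h ⟩
        1# + h                      ∎

      2ℓ≤ : ℓ + ℓ ≤ lg (1+⁺ h⁺)
      2ℓ≤ = begin
        ℓ + ℓ                        ≈⟨ lg-* (1+⁺ t⁺) (1+⁺ t⁺) ⟨
        lg ((1+⁺ t⁺) *⁺ (1+⁺ t⁺))    ≤⟨ lg-mono-≤ ((1+⁺ t⁺) *⁺ (1+⁺ t⁺)) (1+⁺ h⁺) [1+t]²≤1+h ⟩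
        lg (1+⁺ h⁺)                  ∎

      ℓ≤[1+n]ℓ : ℓ ≤ fromℕ (suc n) * ℓ
      ℓ≤[1+n]ℓ = begin
        ℓ                   ≈⟨ +-identityʳ ℓ ⟨
        ℓ + 0#              ≈⟨ +-congˡ (zeroʳ ℓ) ⟨
        ℓ + ℓ * 0#          ≤⟨ +-monoʳ-≤ ℓ (*-monoʳ-≤ (lg-1+-pos t⁺) (0≤fromℕ n)) ⟩
        ℓ + ℓ * fromℕ n     ≈⟨ +-congˡ (*-comm ℓ _) ⟩
        ℓ + fromℕ n * ℓ     ≈⟨ fromℕ-suc-* n ℓ ⟨
        fromℕ (suc n) * ℓ   ∎

  -- If `y < x`, the gap `ε` lies below every `lg (1 + h)`. Some `n` has `n ε > 1`, while
  -- `lg-1+-small` at this `n` supplies an `h` with `(n + 1) lg (1 + h) ≤ 1`.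
  ≤-up-to-lg-1+ : ∀ {x y} → (∀ h → x ≤ lg (1+⁺ h) + y) → x ≤ y
  ≤-up-to-lg-1+ {x} {y} x≤ℓ+y y<x = impossible (archimedean-* 1# 0<ε)
    where
    ε : Carrier
    ε = x + - y

    0<ε : 0# < ε
    0<ε = <-respˡ-≈ (-‿inverseʳ y) (<-respˡ-≈ (+-comm (- y) y) (<-respʳ-≈ (+-comm (- y) x) (+-monoʳ-< (- y) y<x)))

    ε≤ : ∀ h → ε ≤ lg (1+⁺ h)
    ε≤ h = begin
      x + - y                      ≤⟨ +-monoˡ-≤ (- y) (x≤ℓ+y h) ⟩
      (lg (1+⁺ h) + y) + - y       ≈⟨ +-assoc _ y (- y) ⟩
      lg (1+⁺ h) + (y + - y)       ≈⟨ trans (+-congˡ (-‿inverseʳ y)) (+-identityʳ _) ⟩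
      lg (1+⁺ h)                   ∎

    impossible : ¬ (∃[ n ] 1# < fromℕ n * ε)
    impossible (n , 1<nε) = let (h , _ , bound) = lg-1+-small n in <-irrefl refl (begin-strict
      1#                           <⟨ 1<nε ⟩
      fromℕ n * ε                  ≈⟨ *-comm _ ε ⟩
      ε * fromℕ n                  ≤⟨ *-monoʳ-≤ 0<ε (fromℕ-mono-≤ (ℕ.n≤1+n n)) ⟩
      ε * fromℕ (suc n)            ≈⟨ *-comm ε _ ⟩
      fromℕ (suc n) * ε            ≤⟨ *-monoʳ-≤ (0<fromℕ (suc n)) (ε≤ h) ⟩
      fromℕ (suc n) * lg (1+⁺ h)   ≤⟨ bound ⟩
      1#                           ∎)

  -- Logarithms of positive integers.

  lgℕ : (n : ℕ) .{{_ : NonZero n}} → Carrier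
  lgℕ n = lg (fromℕ⁺ n)

  lgℕ-mono-≤ : ∀ {m n} .{{_ : NonZero m}} .{{_ : NonZero n}} → m ℕ.≤ n → lgℕ m ≤ lgℕ n
  lgℕ-mono-≤ {m} {n} m≤n = lg-mono-≤ (fromℕ⁺ m) (fromℕ⁺ n) (begin
    proj₁ (fromℕ⁺ m)  ≈⟨ fromℕ⁺≈fromℕ m ⟩
    fromℕ m           ≤⟨ fromℕ-mono-≤ m≤n ⟩
    fromℕ n           ≈⟨ fromℕ⁺≈fromℕ n ⟨
    proj₁ (fromℕ⁺ n)  ∎)

  lgℕ-* : ∀ m n .{{_ : NonZero m}} .{{_ : NonZero n}} .{{_ : NonZero (m ℕ.* n)}} →
          lgℕ (m ℕ.* n) ≈ lgℕ m + lgℕ n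
  lgℕ-* m n = trans
    (lg-cong (fromℕ⁺ (m ℕ.* n)) (fromℕ⁺ m *⁺ fromℕ⁺ n) (begin-equality
      proj₁ (fromℕ⁺ (m ℕ.* n))              ≈⟨ fromℕ⁺≈fromℕ (m ℕ.* n) ⟩
      fromℕ (m ℕ.* n)                       ≈⟨ fromℕ-homo-* m n ⟩
      fromℕ m * fromℕ n                     ≈⟨ *-cong (fromℕ⁺≈fromℕ m) (fromℕ⁺≈fromℕ n) ⟨
      proj₁ (fromℕ⁺ m) * proj₁ (fromℕ⁺ n)   ∎))
    (lg-* (fromℕ⁺ m) (fromℕ⁺ n))

  lgℕ-^ : ∀ n k .{{_ : NonZero n}} .{{_ : NonZero (n ℕ.^ k)}} → lgℕ (n ℕ.^ k) ≈ fromℕ k * lgℕ n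
  lgℕ-^ n zero    = begin-equality
    lgℕ 1          ≈⟨ lg-cong (fromℕ⁺ 1) 1⁺ (+-identityʳ 1#) ⟩
    lg 1⁺          ≈⟨ lg-1 ⟩
    0#             ≈⟨ zeroˡ (lgℕ n) ⟨
    0# * lgℕ n     ∎
  lgℕ-^ n (suc k) = begin-equality
    lgℕ (n ℕ.* n ℕ.^ k)      ≈⟨ lgℕ-* n (n ℕ.^ k) ⟩
    lgℕ n + lgℕ (n ℕ.^ k)    ≈⟨ +-congˡ (lgℕ-^ n k) ⟩
    lgℕ n + fromℕ k * lgℕ n  ≈⟨ fromℕ-suc-* k (lgℕ n) ⟨
    fromℕ (suc k) * lgℕ n    ∎
    where
    instance
      n^k≢0 : NonZero (n ℕ.^ k)
      n^k≢0 = ℕ.m^n≢0 n k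

-- Finite sums, events of probability one, and uniform distributions.

module Bounds {c ℓ₁ ℓ₂ ℓ₃} (ℝ : RealNumbers c ℓ₁ ℓ₂ ℓ₃) (logarithm : BinaryLogarithm ℝ) where
  open Coding ℝ logarithm
  open OrderedField ℝ
  open Logarithm ℝ logarithm
  open IsStrictPartialOrder <-isStrictPartialOrder using (asym)
  open CommutativeRing commutativeRing using (commutativeSemiring)
  open SemiringSolver commutativeSemiring using (solve; _:+_; _:*_; _:=_)
  open ≤-Reasoning

  private variable A : Set

  nonNegative⇒0≤ : ∀ {x} → NonNegative x → 0# ≤ x
  nonNegative⇒0≤ = [ ≤-reflexive ∘ sym , asym ]′

  sumOver-mono-≤ : ∀ (xs : List A) {f g} → (∀ x → f x ≤ g x) → sumOver xs f ≤ sumOver xs g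
  sumOver-mono-≤ []       f≤g = ≤-refl
  sumOver-mono-≤ (x ∷ xs) f≤g = +-mono-≤ (f≤g x) (sumOver-mono-≤ xs f≤g)

  0<+0≤ : ∀ {x y} → 0# < x → NonNegative y → 0# < x + y
  0<+0≤ 0<x 0≤y = <-≤-trans 0<x (begin
    _       ≈⟨ +-identityʳ _ ⟨
    _ + 0#  ≤⟨ +-monoʳ-≤ _ (nonNegative⇒0≤ 0≤y) ⟩
    _       ∎)

  sumOver-pos : ∀ {xs : List A} {f x} → (∀ x → NonNegative (f x)) → x ∈ˡ xs → 0# < f x → 0# < sumOver xs f
  sumOver-pos {xs = _ ∷ xs} f≥0 (here ≡.refl) 0<fx = 0<+0≤ 0<fx (sumOver-nonNegative xs f≥0)
  sumOver-pos {xs = y ∷ xs} f≥0 (there x∈xs)  0<fx =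
    <-respʳ-≈ (+-comm _ _) (0<+0≤ (sumOver-pos f≥0 x∈xs 0<fx) (f≥0 y))

  sumOver-partition : ∀ {p} {P : Pred A p} (P? : Decidable P) xs f →
    sumOver (filter P? xs) f + sumOver (filter (∁? P?) xs) f ≈ sumOver xs f
  sumOver-partition P? []       f = +-identityˡ 0#
  sumOver-partition P? (x ∷ xs) f with does (P? x)
  ... | true  = trans (+-assoc _ _ _) (+-congˡ (sumOver-partition P? xs f))
  ... | false = trans (solve 3 (λ a b c → a :+ (b :+ c) := b :+ (a :+ c)) refl _ (f x) _)
                      (+-congˡ (sumOver-partition P? xs f))

  -- A point of positive mass violating `P` would give the complement positive probability and push
  -- the total above 1. Decidability of `P` removes the double negation.
  Pr≈1⇒certain : ∀ {p} {P : Pred A p} {xs} (σ : Distribution xs) (P? : Decidable P) → Pr σ P? ≈ 1# →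
    ∀ {x} → x ∈ˡ xs → 0# < mass σ x → P x
  Pr≈1⇒certain {xs = xs} σ P? PrP≈1 {x} x∈xs 0<x = decidable-stable (P? x) λ ¬Px → <-irrefl refl (begin-strict
    1#                                     ≈⟨ +-identityʳ 1# ⟨
    1# + 0#                                <⟨ +-monoʳ-< 1# (sumOver-pos (nonNeg σ) (∈-filter⁺ (∁? P?) x∈xs ¬Px) 0<x) ⟩
    1# + Pr σ (∁? P?)                      ≈⟨ +-congʳ PrP≈1 ⟨
    Pr σ P? + Pr σ (∁? P?)                 ≈⟨ sumOver-partition P? xs (mass σ) ⟩
    sumOver xs (mass σ)                    ≈⟨ total≈1 σ ⟩
    1#                                     ∎)

  weight-pos : ∀ {w : A → Carrier} (t : Vec A k) → (∀ {x} → x ∈ᵛ t → 0# < w x) → 0# < weight w t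
  weight-pos []      0<w = 0<1
  weight-pos (x ∷ t) 0<w = *-pos (0<w (VecAny.here ≡.refl)) (weight-pos t (0<w ∘ VecAny.there))

  -- The tuple `t` is itself one of the tuples summed over, and its weight is a product of positive
  -- masses.
  iid-pos : ∀ (μ : ItemDistribution N) (t : Vec (Fin N) k) → (∀ {i} → i ∈ᵛ t → 0# < mass μ i) →
            0# < mass (iid μ k) (itemSet t)
  iid-pos {k = k} μ t 0<μ = sumOver-pos (weight-nonNegative (nonNeg μ))
    (∈-filter⁺ (λ t′ → itemSet t′ ≟ˢ itemSet t) (∈-vectors ∈-allFin t) ≡.refl) (weight-pos t 0<μ)

  indicator : Carrier → Subset N → Fin N → Carrier
  indicator u M i = if lookup M i then u else 0#

  indicator-∈ : ∀ {u} {M : Subset N} {i} → i ∈ M → indicator u M i ≈ u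
  indicator-∈ {u = u} i∈M = reflexive (≡.cong (if_then u else 0#) (Vec.[]=⇒lookup i∈M))

  indicator-nonNegative : ∀ {u} (M : Subset N) → 0# < u → ∀ i → NonNegative (indicator u M i)
  indicator-nonNegative M 0<u i with lookup M i
  ... | true  = inj₂ 0<u
  ... | false = inj₁ refl

  sumOver-indicator : ∀ u (M : Subset N) → sumOver (allFin N) (indicator u M) ≈ fromℕ ∣ M ∣ * u
  sumOver-indicator u []      = sym (zeroˡ u)
  sumOver-indicator {suc N} u (s ∷ M) = trans (+-congˡ tail) (head s)
    where
    tail : sumOver (tabulate suc) (indicator u (s ∷ M)) ≈ fromℕ ∣ M ∣ * u
    tail = begin-equality
      sumOver (tabulate suc) (indicator u (s ∷ M))
        -- The tail of `allFin (suc N)` is `tabulate suc`; rewritten as a `map`, it lets the sum be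
        -- reindexed over `allFin N`.
        ≡⟨ ≡.cong (λ xs → sumOver xs (indicator u (s ∷ M))) (List.map-tabulate (λ i → i) suc) ⟨
      sumOver (List.map suc (allFin N)) (indicator u (s ∷ M))
        ≈⟨ sumOver-map suc (allFin N) (indicator u (s ∷ M)) ⟩
      sumOver (allFin N) (indicator u M)
        ≈⟨ sumOver-indicator u M ⟩
      fromℕ ∣ M ∣ * u ∎

    head : ∀ s → (if s then u else 0#) + fromℕ ∣ M ∣ * u ≈ fromℕ ∣ s ∷ M ∣ * u
    head true  = sym (fromℕ-suc-* ∣ M ∣ u)
    head false = +-identityˡ _

  fromℕ*1/≈1 : ∀ n .{{_ : NonZero n}} → fromℕ n * proj₁ (1/⁺ fromℕ⁺ n) ≈ 1#
  fromℕ*1/≈1 n = trans (*-congʳ (sym (fromℕ⁺≈fromℕ n))) (*-1/⁺ (fromℕ⁺ n))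

  -- Serves both as the total mass of `uniform` and, in `Entropy.H≤`, as the total of the weights
  -- compared with `μ`.
  sumOver-indicator-1/ : ∀ n .{{_ : NonZero n}} (M : Subset N) → ∣ M ∣ ≡ n →
    sumOver (allFin N) (indicator (proj₁ (1/⁺ fromℕ⁺ n)) M) ≈ 1#
  sumOver-indicator-1/ n M ≡.refl = trans (sumOver-indicator _ M) (fromℕ*1/≈1 n)

  uniform : ∀ n .{{_ : NonZero n}} (M : Subset N) → ∣ M ∣ ≡ n → ItemDistribution N
  uniform n M ∣M∣≡n = record
    { mass    = indicator (proj₁ (1/⁺ fromℕ⁺ n)) M
    ; nonNeg  = indicator-nonNegative M (proj₂ (1/⁺ fromℕ⁺ n))
    ; total≈1 = sumOver-indicator-1/ n M ∣M∣≡n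
    }

  uniform-supported : ∀ n .{{_ : NonZero n}} (M : Subset N) (∣M∣≡n : ∣ M ∣ ≡ n) →
                      uniform n M ∣M∣≡n SupportedOn M
  uniform-supported n M _ i = supported (lookup M i) ≡.refl
    where
    supported : ∀ s → lookup M i ≡ s → 0# < (if s then proj₁ (1/⁺ fromℕ⁺ n) else 0#) → i ∈ M
    supported true  i∈M _   = Vec.lookup⇒[]= i M i∈M
    supported false _   0<0 = contradiction 0<0 (<-irrefl refl)

  -- The lower bound on the message length.

  module Encoding {N k m : ℕ} .{{_ : NonZero N}} .{{_ : NonZero k}} (2k≤N : 2 ℕ.* k ℕ.≤ N)
                  (scheme : Scheme N m) (handles : ∀ σ → Family N k σ → HandlesWithoutError scheme σ) where
    open Scheme scheme

    instance
      2k≢0 : NonZero (2 ℕ.* k)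
      2k≢0 = ℕ.m*n≢0 2 k

    decodes : ∀ (M : Subset N) (∣M∣≡2k : ∣ M ∣ ≡ 2 ℕ.* k) (t : Vec (Fin N) k) → itemSet t ⊆ M →
              Dec (iid (uniform (2 ℕ.* k) M ∣M∣≡2k) k) (Enc (itemSet t)) ≡ itemSet t
    decodes M ∣M∣≡2k t t⊆M = Pr≈1⇒certain (iid μ k) (λ S → Dec (iid μ k) (Enc S) ≟ˢ S)
      (handles (iid μ k) (family μ (M , ∣M∣≡2k , uniform-supported (2 ℕ.* k) M ∣M∣≡2k)))
      (∈-subsets (itemSet t))
      (iid-pos μ t λ i∈t → <-respʳ-≈ (sym (indicator-∈ (t⊆M (∈-itemSet⁺ i∈t)))) (proj₂ (1/⁺ fromℕ⁺ (2 ℕ.* k))))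
      where μ = uniform (2 ℕ.* k) M ∣M∣≡2k

    -- Both sets fit into one `M` of size `2k`, so a single prior, uniform on `M`, gives both
    -- positive mass. One and the same decoder then recovers each set from the common codeword.
    Enc-injective : ∀ (t t′ : Vec (Fin N) k) → Enc (itemSet t) ≡ Enc (itemSet t′) → itemSet t ≡ itemSet t′
    Enc-injective t t′ eq =
      let (M , ∪⊆M , ∣M∣≡2k) = superset-of-size (itemSet t ∪ itemSet t′) ∣∪∣≤2k 2k≤N in
      ≡.trans (≡.sym (decodes M ∣M∣≡2k t (∪⊆M ∘ p⊆p∪q (itemSet t′))))
      (≡.trans (≡.cong (Dec (iid (uniform (2 ℕ.* k) M ∣M∣≡2k) k)) eq)
               (decodes M ∣M∣≡2k t′ (∪⊆M ∘ q⊆p∪q (itemSet t) (itemSet t′))))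
      where
      ∣∪∣≤2k : ∣ itemSet t ∪ itemSet t′ ∣ ℕ.≤ 2 ℕ.* k
      ∣∪∣≤2k = ℕ.≤-trans (∣p∪q∣≤∣p∣+∣q∣ (itemSet t) (itemSet t′))
        -- `2 * k` unfolds to `k + (k + 0)`, hence the extra `0`.
        (ℕ.+-mono-≤ (∣itemSet∣≤ t) (ℕ.≤-trans (∣itemSet∣≤ t′) (ℕ.m≤m+n k 0)))

    q : ℕ
    q = N / k

    kq≤N : k ℕ.* q ℕ.≤ N
    kq≤N = ≡.subst (ℕ._≤ N) (ℕ.*-comm q k) (m/n*n≤m N k)

    q^k≤2^m : q ℕ.^ k ℕ.≤ 2 ℕ.^ m
    q^k≤2^m = functions≤words (Enc ∘ itemSet ∘ transversal kq≤N) λ a b eq →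
      transversal-injective kq≤N a b (Enc-injective (transversal kq≤N a) (transversal kq≤N b) eq)

    instance
      q≢0 : NonZero q
      q≢0 = ℕ.>-nonZero (ℕ.<⇒≤ (2≤N/k N k 2k≤N))
      q*q≢0 : NonZero (q ℕ.* q)
      q*q≢0 = ℕ.m*n≢0 q q
      k*q*q≢0 : NonZero (k ℕ.* (q ℕ.* q))
      k*q*q≢0 = ℕ.m*n≢0 k (q ℕ.* q)
      q^k≢0 : NonZero (q ℕ.^ k)
      q^k≢0 = ℕ.m^n≢0 q k
      2^m≢0 : NonZero (2 ℕ.^ m)
      2^m≢0 = ℕ.m^n≢0 2 m

    k*lgq≤m : fromℕ k * lgℕ q ≤ fromℕ m
    k*lgq≤m = begin
      fromℕ k * lgℕ q    ≈⟨ lgℕ-^ q k ⟨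
      lgℕ (q ℕ.^ k)      ≤⟨ lgℕ-mono-≤ q^k≤2^m ⟩
      lgℕ (2 ℕ.^ m)      ≈⟨ lgℕ-^ 2 m ⟩
      fromℕ m * lgℕ 2    ≈⟨ *-congˡ lg-2 ⟩
      fromℕ m * 1#       ≈⟨ *-identityʳ _ ⟩
      fromℕ m            ∎

    -- Taking logarithms in `N ≤ k q q` and cancelling `lg k` leaves two copies of `lg q`, the
    -- source of the constant 1/2.
    lg[N/k]≤ : lg[ N / k ] ≤ lgℕ q + lgℕ q
    lg[N/k]≤ = +-cancelʳ-≤ (lgℕ k) (begin
      lg[ N / k ] + lgℕ k          ≈⟨ lg-/ (fromℕ⁺ N) (fromℕ⁺ k) ⟩
      lgℕ N                        ≤⟨ lgℕ-mono-≤ (N≤k*q*q N k 2k≤N) ⟩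
      lgℕ (k ℕ.* (q ℕ.* q))        ≈⟨ lgℕ-* k (q ℕ.* q) ⟩
      lgℕ k + lgℕ (q ℕ.* q)        ≈⟨ +-congˡ (lgℕ-* q q) ⟩
      lgℕ k + (lgℕ q + lgℕ q)      ≈⟨ +-comm _ _ ⟩
      (lgℕ q + lgℕ q) + lgℕ k      ∎)

    message-length : fromℕ k * lg[ N / k ] ≤ fromℕ m + fromℕ m
    message-length = begin
      fromℕ k * lg[ N / k ]                  ≤⟨ *-monoʳ-≤ (0<fromℕ k) lg[N/k]≤ ⟩
      fromℕ k * (lgℕ q + lgℕ q)              ≈⟨ distribˡ _ _ _ ⟩
      fromℕ k * lgℕ q + fromℕ k * lgℕ q      ≤⟨ +-mono-≤ k*lgq≤m k*lgq≤m ⟩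
      fromℕ m + fromℕ m                      ∎

  1/2 : Carrier
  1/2 = proj₁ (1/⁺ fromℕ⁺ 2)

  1/2*[x+x]≈x : ∀ x → 1/2 * (x + x) ≈ x
  1/2*[x+x]≈x x = begin-equality
    1/2 * (x + x)           ≈⟨ *-congˡ (+-congˡ (trans (fromℕ-suc-* 0 x) (trans (+-congˡ (zeroˡ x)) (+-identityʳ x)))) ⟨
    1/2 * (x + fromℕ 1 * x) ≈⟨ *-congˡ (fromℕ-suc-* 1 x) ⟨
    1/2 * (fromℕ 2 * x)     ≈⟨ solve 3 (λ a b c → a :* (b :* c) := (b :* a) :* c) refl 1/2 (fromℕ 2) x ⟩
    (fromℕ 2 * 1/2) * x     ≈⟨ *-congʳ (fromℕ*1/≈1 2) ⟩
    1# * x                  ≈⟨ *-identityˡ x ⟩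
    x                       ∎

  -- The entropy bound.

  module Entropy (h⁺ : ℝ⁺) where
    open Secant h⁺ using (h; ℓ; 0<h; 0<ℓ; below)

    -- With p the mass of an item, this is Secant.below at 1 / (n p), multiplied by p.
    entropyTerm-≤ : ∀ n .{{_ : NonZero n}} {p u} (p≥0 : NonNegative p) → NonNegative u →
      (0# < p → u ≈ proj₁ (1/⁺ fromℕ⁺ n)) →
      h * entropyTerm p p≥0 + ℓ * p ≤ ℓ * u + h * (ℓ + lgℕ n) * p
    entropyTerm-≤ n {p} {u} (inj₁ p≈0) u≥0 _ = begin
      h * 0# + ℓ * p                    ≈⟨ +-cong (zeroʳ h) (trans (*-congˡ p≈0) (zeroʳ ℓ)) ⟩
      0# + 0#                           ≈⟨ +-cong (zeroʳ ℓ) (trans (*-congˡ p≈0) (zeroʳ _)) ⟨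
      ℓ * 0# + h * (ℓ + lgℕ n) * p      ≤⟨ +-monoˡ-≤ _ (*-monoʳ-≤ 0<ℓ (nonNegative⇒0≤ u≥0)) ⟩
      ℓ * u + h * (ℓ + lgℕ n) * p       ∎
    entropyTerm-≤ n {p} {u} (inj₂ 0<p) _ u≈1/n = begin
      h * (p * lg (1/⁺ p⁺)) + ℓ * p                 ≈⟨ +-congʳ (*-congˡ (*-congˡ (lg-/ (1/⁺ p⁺) (fromℕ⁺ n)))) ⟨
      h * (p * (lg y + lgℕ n)) + ℓ * p              ≈⟨ solve 5 (λ h p l ln ℓ → h :* (p :* (l :+ ln)) :+ ℓ :* p
                                                                  := p :* (h :* l :+ ℓ) :+ (h :* ln) :* p)
                                                             refl h p (lg y) (lgℕ n) ℓ ⟩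
      p * (h * lg y + ℓ) + h * lgℕ n * p            ≤⟨ +-monoˡ-≤ _ (*-monoʳ-≤ 0<p (below y)) ⟩
      p * (ℓ * (proj₁ y + h)) + h * lgℕ n * p       ≈⟨ solve 5 (λ h p y ln ℓ → p :* (ℓ :* (y :+ h)) :+ (h :* ln) :* p
                                                                  := ℓ :* (p :* y) :+ (h :* (ℓ :+ ln)) :* p)
                                                             refl h p (proj₁ y) (lgℕ n) ℓ ⟩
      ℓ * (p * proj₁ y) + h * (ℓ + lgℕ n) * p       ≈⟨ +-congʳ (*-congˡ p*y≈u) ⟩
      ℓ * u + h * (ℓ + lgℕ n) * p                   ∎
      where
      p⁺ y : ℝ⁺
      p⁺ = p , 0<p
      y = 1/⁺ p⁺ /⁺ fromℕ⁺ n

      p*y≈u : p * proj₁ y ≈ u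
      p*y≈u = trans (sym (*-assoc p _ _)) (trans (*-congʳ (*-1/⁺ p⁺)) (trans (*-identityˡ _) (sym (u≈1/n 0<p))))

    -- Summing `entropyTerm-≤` over the items, the masses and the weights `1/n` on `M` both total 1.
    -- An `ℓ` then cancels on each side, and after it the factor `h`.
    H≤ : ∀ n .{{_ : NonZero n}} (μ : ItemDistribution N) (M : Subset N) → ∣ M ∣ ≡ n → μ SupportedOn M →
         H μ ≤ ℓ + lgℕ n
    H≤ {N} n μ M ∣M∣≡n supp = *-cancelˡ-≤ 0<h (+-cancelʳ-≤ ℓ (begin
      h * H μ + ℓ
        ≈⟨ +-congˡ (trans (*-congˡ (total≈1 μ)) (*-identityʳ ℓ)) ⟨
      h * H μ + ℓ * sumOver items (mass μ)
        ≈⟨ +-cong (sumOver-*ˡ items h _) (sumOver-*ˡ items ℓ _) ⟨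
      sumOver items (λ i → h * term i) + sumOver items (λ i → ℓ * mass μ i)
        ≈⟨ sumOver-+ items _ _ ⟨
      sumOver items (λ i → h * term i + ℓ * mass μ i)
        ≤⟨ sumOver-mono-≤ items (λ i → entropyTerm-≤ n (nonNeg μ i)
             (indicator-nonNegative M (proj₂ (1/⁺ fromℕ⁺ n)) i) (λ 0<p → indicator-∈ (supp i 0<p))) ⟩
      sumOver items (λ i → ℓ * indicator u M i + h * (ℓ + lgℕ n) * mass μ i)
        ≈⟨ sumOver-+ items _ _ ⟩
      sumOver items (λ i → ℓ * indicator u M i) + sumOver items (λ i → h * (ℓ + lgℕ n) * mass μ i)
        ≈⟨ +-cong (sumOver-*ˡ items ℓ _) (sumOver-*ˡ items _ _) ⟩
      ℓ * sumOver items (indicator u M) + h * (ℓ + lgℕ n) * sumOver items (mass μ)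
        ≈⟨ +-cong (*-congˡ (sumOver-indicator-1/ n M ∣M∣≡n)) (*-congˡ (total≈1 μ)) ⟩
      ℓ * 1# + h * (ℓ + lgℕ n) * 1#
        ≈⟨ +-cong (*-identityʳ ℓ) (*-identityʳ _) ⟩
      ℓ + h * (ℓ + lgℕ n)
        ≈⟨ +-comm _ _ ⟩
      h * (ℓ + lgℕ n) + ℓ ∎))
      where
      items = allFin N
      u = proj₁ (1/⁺ fromℕ⁺ n)

      term : Fin N → Carrier
      term i = entropyTerm (mass μ i) (nonNeg μ i)

  -- The excess `ℓ` is `lg (1 + h)` with `h` free, so it can be made to vanish.
  H≤lg : ∀ n .{{_ : NonZero n}} (μ : ItemDistribution N) (M : Subset N) → ∣ M ∣ ≡ n → μ SupportedOn M →
         H μ ≤ lgℕ n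
  H≤lg n μ M ∣M∣≡n supp = ≤-up-to-lg-1+ λ h → Entropy.H≤ h n μ M ∣M∣≡n supp

claim4p1 : ∀ {c ℓ₁ ℓ₂ ℓ₃} (ℝ : RealNumbers c ℓ₁ ℓ₂ ℓ₃) (logarithm : BinaryLogarithm ℝ) →
    let open Coding ℝ logarithm in
    ∃[ C ] ((0# < C) ×
    (∀ (N k : ℕ) .{{_ : NonZero N}} .{{_ : NonZero k}} → 2 ℕ.* k ℕ.≤ N →
    (∀ (m : ℕ) (scheme : Scheme N m) →
    (∀ σ → Family N k σ → HandlesWithoutError scheme σ) →
    C * (fromℕ k * lg[ N / k ]) ≤ fromℕ m)
    ×
    (∀ (μ : ItemDistribution N) → SupportedOn2k k μ →
    m* k μ ≤ fromℕ k * lg[2* k ])))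
claim4p1 ℝ logarithm = 1/2 , 0<1/2 , λ N k 2k≤N →
    (λ m scheme handles → ≤-trans (*-monoʳ-≤ 0<1/2 (Encoding.message-length 2k≤N scheme handles))
                                  (≤-reflexive (1/2*[x+x]≈x (fromℕ m))))
  , (λ μ (M , ∣M∣≡2k , supp) → *-monoʳ-≤ (0<fromℕ k) (H≤lg (2 ℕ.* k) {{ℕ.m*n≢0 2 k}} μ M ∣M∣≡2k supp))
  where
  open Coding ℝ logarithm
  open OrderedField ℝ
  open Bounds ℝ logarithm

  0<1/2 : 0# < 1/2
  0<1/2 = proj₂ (1/⁺ fromℕ⁺ 2)
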